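{- Let $k \geq 1$. Every $k$-degenerate graph $G$ on $n$ vertices is $(k,b)$-colorable for every integer $b \geq 4k\sqrt{k+1}\sqrt{n}$. In other words, $\mathrm{ex}_k(\mathcal{D}_k)(n) \leq 4k\sqrt{k+1}\sqrt{n}$, where $\mathcal{D}_k$ is the class of $k$-degenerate graphs.
   Context: A graph is $k$-degenerate if every subgraph has a vertex of degree at most $k$. A set of vertices $X$ is $2$-independent if any two distinct vertices of $X$ are at distance at least $3$. A graph $G$ is $(a,b)$-colorable if $V(G)$ can be partitioned into $a$ independent sets and $b$ $2$-independent sets (some parts may be empty). For a class $\mathcal{C}$ of graphs, $\mathrm{ex}_a(\mathcal{C})(n)$ denotes the smallest integer $c$ such that every graph of order $n$ in $\mathcal{C}$ is $(a,c)$-colorable. -}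

module Defs where

open import Data.Fin using (Fin)
open import Data.Fin.Subset using (Subset; _∈_; _∉_; _⊆_; Nonempty; ∣_∣)
open import Data.Nat using (ℕ; zero; suc; _+_; _*_; _^_; _≤_)
open import Data.Product using (_×_; Σ-syntax; ∃-syntax)
open import Data.Sum using (_⊎_; inj₁; inj₂)
open import Level using (0ℓ)
open import Relation.Binary.PropositionalEquality using (_≡_; _≢_)
open import Relation.Unary using (Pred)

-- Finite simple graphs of order n, given by their neighbourhoods.
record Graph (n : ℕ) : Set where
  field
    N      : Fin n → Subset n
    irrefl : ∀ {v} → v ∉ N v
    sym    : ∀ {u v} → u ∈ N v → v ∈ N u

-- Subgraphs are not assumed to be induced.  By sym and N⊆V, vertices
-- outside V have no neighbours in the subgraph.
record Subgraph {n : ℕ} (G : Graph n) : Set where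
  field
    V   : Subset n
    N   : Fin n → Subset n
    N⊆V : ∀ {v} → N v ⊆ V
    N⊆G : ∀ {v} → N v ⊆ Graph.N G v
    sym : ∀ {u v} → u ∈ N v → v ∈ N u

  degree : Fin n → ℕ
  degree v = ∣ N v ∣

GraphClass : Set₁
GraphClass = ∀ {n} → Graph n → Set

-- The null subgraph has no vertices at all, so it is excluded.
Degenerate : ℕ → GraphClass
Degenerate k G = (H : Subgraph G) → let open Subgraph H in
  Nonempty V → ∃[ v ] (v ∈ V × degree v ≤ k)

module _ {n : ℕ} (G : Graph n) where
  open Graph G

  data Walk : ℕ → Fin n → Fin n → Set where
    []  : ∀ {v} → Walk zero v v
    _∷_ : ∀ {ℓ u v w} → v ∈ N u → Walk ℓ v w → Walk (suc ℓ) u w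

  -- The distance of u and v is the least length of a walk between them, and
  -- infinite if there is none.
  DistanceAtLeast : ℕ → Fin n → Fin n → Set
  DistanceAtLeast d u v = ∀ {ℓ} → Walk ℓ u v → d ≤ ℓ

  Independent : Pred (Fin n) 0ℓ → Set
  Independent X = ∀ {u v} → X u → X v → u ∉ N v

  2-Independent : Pred (Fin n) 0ℓ → Set
  2-Independent X = ∀ {u v} → X u → X v → u ≢ v → DistanceAtLeast 3 u v

  -- A partition into a + b possibly empty parts is encoded by the map sending
  -- each vertex to the index of its part.
  Colorable : ℕ → ℕ → Set
  Colorable a b = Σ[ part ∈ (Fin n → Fin a ⊎ Fin b) ]
    ( (∀ (i : Fin a) → Independent (λ v → part v ≡ inj₁ i))
    × (∀ (j : Fin b) → 2-Independent (λ v → part v ≡ inj₂ j)))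

AllColorable : ℕ → GraphClass → ℕ → ℕ → Set
AllColorable a 𝒞 n c = (G : Graph n) → 𝒞 G → Colorable G a c

-- IsEx a 𝒞 n c says that ex_a(𝒞)(n) = c.
IsEx : ℕ → GraphClass → ℕ → ℕ → Set
IsEx a 𝒞 n c = AllColorable a 𝒞 n c × (∀ c′ → AllColorable a 𝒞 n c′ → c ≤ c′)

-- The square of 4k√(k+1)√n.  An m : ℕ satisfies m ≥ 4k√(k+1)√n, respectively
-- m ≤ 4k√(k+1)√n, iff the same inequality holds between m² and boundSq k n.
boundSq : ℕ → ℕ → ℕ
boundSq k n = (4 * k) ^ 2 * (k + 1) * n

{-# OPTIONS --safe #-}

-- Order the vertices so that every vertex has at most k earlier neighbours, and
-- call a vertex high if it has at least d later neighbours; there are at most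
-- kn/d high vertices.  Colour greedily, the high vertices first, each as a
-- 2-independent part of its own.  A low vertex with an earlier neighbour in a
-- 2-independent part sees at most k - 1 of the k independent parts, so one of
-- these is free.  Otherwise all its earlier neighbours are low and lie in
-- independent parts; it is then not adjacent to any coloured low vertex in a
-- 2-independent part, and it has a common neighbour with at most k(d + k) + dk
-- coloured low vertices.  For d about b/4k these and the high vertices are
-- fewer than b.
module Submission where

open import Data.Bool using (if_then_else_; true; false)
open import Data.Empty using (⊥-elim)
open import Data.Fin using (Fin; inject≤; fromℕ<) renaming (_≟_ to _≟ᶠ_)
open import Data.Fin.Properties using (any?; ¬∀⟶∃¬; injective⇒≤; inject≤-injective)
open import Data.Fin.Subset using (Subset; _∈_; _∩_; _-_; ⊤; ⊥; ∣_∣)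
open import Data.Fin.Subset.Properties
  using (_∈?_; x∈p⇒∣p-x∣<∣p∣; x∈p∧x≢y⇒x∈p-y; ∉⊥; ∈⊤; x∈p∩q⁺; x∈p∩q⁻; ∣⊤∣≡n; nonempty?)
open import Data.List using (List; []; _∷_; _++_; length; filter; concatMap; allFin; map; lookup)
open import Data.List.Membership.Propositional using (lose) renaming (_∈_ to _∈ᴸ_)
open import Data.List.Membership.Propositional.Properties
  using (∈-filter⁺; ∈-filter⁻; ∈-concatMap⁺; ∈-allFin; ∈-++⁺ˡ; ∈-++⁺ʳ)
open import Data.List.Properties using (length-++; filter-notAll; length-tabulate)
open import Data.List.Relation.Unary.All as All using (All; []; _∷_; all?)
open import Data.List.Relation.Unary.All.Properties using (¬All⇒Any¬)
open import Data.List.Relation.Unary.AllPairs using ([]; _∷_)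
open import Data.List.Relation.Unary.Any as Any using (Any)
open import Data.List.Relation.Unary.Any.Properties using (lookup-index)
open import Data.List.Relation.Unary.Unique.Propositional using (Unique)
import Data.List.Relation.Unary.Unique.Propositional.Properties as Unique
open import Data.Nat
open import Data.Nat.ListAction using (sum)
open import Data.Nat.DivMod using (_/_; _%_; m≡m%n+[m/n]*n; m%n<n; m/n*n≤m)
open import Data.Nat.Properties
open import Data.Nat.Tactic.RingSolver using (solve-∀)
open import Algebra.Properties.CommutativeSemigroup +-commutativeSemigroup using (x∙yz≈y∙xz)
open import Data.Product using (_×_; _,_; proj₁; proj₂; ∃; ∃-syntax)
open import Data.Sum using (_⊎_; inj₁; inj₂; [_,_]′)
open import Data.Sum.Properties using (≡-dec; inj₁-injective; inj₂-injective)
open import Data.Vec using () renaming (lookup to lookupⱽ)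
open import Data.Vec.Functional using (updateAt)
open import Data.Vec.Functional.Properties using (updateAt-updates; updateAt-minimal)
open import Data.Vec.Properties using ([]=⇒lookup; lookup⇒[]=)
open import Function using (_∘_; const; id)
open import Function.Definitions using (Injective)
open import Level using (Level)
open import Relation.Binary using (DecidableEquality; tri<; tri≈; tri>)
open import Relation.Binary.PropositionalEquality
open import Relation.Nullary using (¬_; yes; no; does; contradiction; _×-dec_)
open import Relation.Nullary.Decidable using (toSum)
import Relation.Binary as B
import Relation.Unary as U
open import Defs

private
  variable
    a p : Level
    A B C : Set a
    n : ℕ

-- Double counting, lengths of lists and the pigeonhole principle.

module _ {R : A → B → Set p} (R? : B.Decidable R) where

  sum-filter-∷ : ∀ x xs ys →
    sum (map (λ y → length (filter (λ z → R? z y) (x ∷ xs))) ys)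
      ≡ length (filter (R? x) ys) + sum (map (λ y → length (filter (λ z → R? z y) xs)) ys)
  sum-filter-∷ x xs []       = refl
  sum-filter-∷ x xs (y ∷ ys) with does (R? x y)
  ... | true  = cong suc (trans (cong (c +_) (sum-filter-∷ x xs ys)) (x∙yz≈y∙xz c (length (filter (R? x) ys)) _))
    where
    c = length (filter (λ z → R? z y) xs)
  ... | false = trans (cong (c +_) (sum-filter-∷ x xs ys)) (x∙yz≈y∙xz c (length (filter (R? x) ys)) _)
    where
    c = length (filter (λ z → R? z y) xs)

  -- Related pairs are counted by rows and by columns. The induction removes one row, which
  -- `sum-filter-∷` takes out of every column at once.
  double-count : ∀ xs ys →
    sum (map (λ x → length (filter (R? x) ys)) xs)
      ≡ sum (map (λ y → length (filter (λ x → R? x y) xs)) ys)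
  double-count []       ys = sym (sum-0 ys)
    where
    sum-0 : ∀ (ys : List B) → sum (map (λ _ → 0) ys) ≡ 0
    sum-0 []       = refl
    sum-0 (_ ∷ ys) = sum-0 ys
  double-count (x ∷ xs) ys =
    trans (cong (length (filter (R? x) ys) +_) (double-count xs ys)) (sym (sum-filter-∷ x xs ys))

sum-map-≤ : ∀ (f : A → ℕ) {m} xs → (∀ x → f x ≤ m) → sum (map f xs) ≤ length xs * m
sum-map-≤ f []       f≤m = z≤n
sum-map-≤ f (x ∷ xs) f≤m = +-mono-≤ (f≤m x) (sum-map-≤ f xs f≤m)

markov : ∀ {P : A → Set p} (P? : U.Decidable P) (f : A → ℕ) {d} → (∀ {x} → P x → d ≤ f x) →
  ∀ xs → length (filter P? xs) * d ≤ sum (map f xs)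
markov P? f d≤f []       = z≤n
markov P? f d≤f (x ∷ xs) with P? x
... | yes px = +-mono-≤ (d≤f px) (markov P? f d≤f xs)
... | no  _  = ≤-trans (markov P? f d≤f xs) (m≤n+m _ (f x))

length-concatMap-≤ : ∀ (f : A → List B) {m xs} → All (λ x → length (f x) ≤ m) xs →
  length (concatMap f xs) ≤ length xs * m
length-concatMap-≤ f []                      = z≤n
length-concatMap-≤ f {m} {x ∷ xs} (fx≤m ∷ h) = begin
  length (f x ++ concatMap f xs)         ≡⟨ length-++ (f x) ⟩
  length (f x) + length (concatMap f xs) ≤⟨ +-mono-≤ fx≤m (length-concatMap-≤ f h) ⟩
  m + length xs * m                      ∎
  where open ≤-Reasoning

-- Deleting the head from `S` makes `S` strictly smaller and keeps all later entries, since they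
-- differ from the head.
unique⇒length≤∣∣ : ∀ {S : Subset n} {xs} → Unique xs → All (_∈ S) xs → length xs ≤ ∣ S ∣
unique⇒length≤∣∣ []             []           = z≤n
unique⇒length≤∣∣ (x∉xs ∷ xs!) (x∈S ∷ xs⊆S) = ≤-trans
  (s≤s (unique⇒length≤∣∣ xs! (All.zipWith (λ (x≢y , y∈S) → x∈p∧x≢y⇒x∈p-y y∈S (x≢y ∘ sym)) (x∉xs , xs⊆S))))
  (x∈p⇒∣p-x∣<∣p∣ x∈S)

-- Pigeonhole: if every `ι i` were hit, the positions of the hits would inject `Fin m` into the
-- positions of `xs`. The map `ι` selects the kind of colour to be searched.
∃-avoiding : ∀ {m} → DecidableEquality C → (ι : Fin m → C) → Injective _≡_ _≡_ ι →
  (f : A → C) (xs : List A) → length xs < m → ∃[ i ] ∀ {x} → x ∈ᴸ xs → f x ≢ ι i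
∃-avoiding {m = m} _≟ᶜ_ ι ι-inj f xs ∣xs∣<m
  = let i , i-free = ¬∀⟶∃¬ m Hit (λ i → Any.any? (λ x → f x ≟ᶜ ι i) xs) ¬all-hit
    in  i , λ x∈xs fx≡ιi → i-free (lose x∈xs fx≡ιi)
  where
  Hit : Fin m → Set _
  Hit i = Any (λ x → f x ≡ ι i) xs
  ¬all-hit : ¬ (∀ i → Hit i)
  ¬all-hit hit = <⇒≱ ∣xs∣<m (injective⇒≤ {f = Any.index ∘ hit} λ {i} {j} eq →
    ι-inj (trans (sym (lookup-index (hit i))) (trans (cong (f ∘ lookup xs) eq) (lookup-index (hit j)))))

-- Greedy colouring along an injective ranking.

module Greedy (r : Fin n → ℕ) (r-inj : Injective _≡_ _≡_ r)
  (Q : Fin n → (Fin n → C) → C → Set)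
  (local : ∀ {v f g c} → (∀ u → r u < r v → f u ≡ g u) → Q v f c → Q v g c)
  (extend : ∀ v f → (∀ u → r u < r v → Q u f (f u)) → ∃ (Q v f))
  (f₀ : Fin n → C)
  where

  -- The colouring is total from the start, with `f₀` as a placeholder on untreated vertices.
  -- Recolouring the vertex of rank `m` changes nothing that `Q` reads at ranks up to `m`, so
  -- `local` carries the earlier conditions over.
  below : ∀ m → ∃[ f ] ∀ v → r v < m → Q v f (f v)
  below zero    = f₀ , λ _ ()
  below (suc m) with below m | any? (λ v → r v ≟ m)
  -- The ranking may have gaps, and at a gap the colouring is kept.
  ... | f , ok | no  ∄v        = f , λ v rv≤m → ok v (≤∧≢⇒< (s≤s⁻¹ rv≤m) (∄v ∘ (v ,_)))
  ... | f , ok | yes (v , refl) with extend v f ok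
  ...   | c , Qvfc = g , ok′
    where
    g = updateAt f v (const c)
    f≗g : ∀ {w} → r w ≤ r v → ∀ u → r u < r w → f u ≡ g u
    f≗g rw≤rv u ru<rw = sym (updateAt-minimal u v f λ { refl → <⇒≱ ru<rw rw≤rv })
    ok′ : ∀ w → r w < suc (r v) → Q w g (g w)
    ok′ w (s≤s rw≤rv) with w ≟ᶠ v
    ... | yes refl = subst (Q v g) (sym (updateAt-updates v f)) (local (f≗g ≤-refl) Qvfc)
    ... | no  w≢v  = subst (Q w g) (sym (updateAt-minimal w v f w≢v))
                       (local (f≗g rw≤rv) (ok w (≤∧≢⇒< rw≤rv (w≢v ∘ r-inj))))

-- Moving a set of vertices to the front of an order.

module Prioritise {P : Fin n → Set} (P? : U.Decidable P)
  (r : Fin n → ℕ) (r<n : ∀ v → r v < n) (r-inj : Injective _≡_ _≡_ r) where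

  -- As `r` stays below `n`, the shift puts all of `P` first and keeps the order of `r` on either
  -- side.
  prio : Fin n → ℕ
  prio v = if does (P? v) then r v else n + r v

  prio<n+n : ∀ v → prio v < n + n
  prio<n+n v with P? v
  ... | yes _ = ≤-trans (r<n v) (m≤m+n n n)
  ... | no  _ = +-monoʳ-< n (r<n v)

  prio-injective : Injective _≡_ _≡_ prio
  prio-injective {u} {v} eq with P? u | P? v
  ... | yes _ | yes _ = r-inj eq
  ... | yes _ | no  _ = contradiction (≤-trans (r<n u) (m≤m+n n (r v))) (<-irrefl eq)
  ... | no  _ | yes _ = contradiction (≤-trans (r<n v) (m≤m+n n (r u))) (<-irrefl (sym eq))
  ... | no  _ | no  _ = r-inj (+-cancelˡ-≡ n _ _ eq)

  before-P : ∀ {u v} → P v → prio u < prio v → P u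
  before-P {u} {v} pv u<v with P? u | P? v
  ... | yes pu | _      = pu
  ... | no  _  | yes _  = contradiction (≤-trans (r<n v) (m≤m+n n (r u))) (<-asym u<v)
  ... | no  _  | no ¬pv = contradiction pv ¬pv

  before-¬P⁺ : ∀ {u v} → ¬ P v → P u ⊎ r u < r v → prio u < prio v
  before-¬P⁺ {u} {v} ¬pv u<v with P? u | P? v
  ... | _      | yes pv = contradiction pv ¬pv
  ... | yes _  | no _   = ≤-trans (r<n u) (m≤m+n n (r v))
  before-¬P⁺ ¬pv (inj₁ pu)    | no ¬pu | no _ = contradiction pu ¬pu
  before-¬P⁺ ¬pv (inj₂ ru<rv) | no _   | no _ = +-monoʳ-< n ru<rv

  before-¬P⁻ : ∀ {u v} → ¬ P v → prio u < prio v → P u ⊎ r u < r v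
  before-¬P⁻ {u} {v} ¬pv u<v with P? u | P? v
  ... | _      | yes pv = contradiction pv ¬pv
  ... | yes pu | no _   = inj₁ pu
  ... | no _   | no _   = inj₂ (+-cancelˡ-< n _ _ u<v)

-- Induced subgraphs and degeneracy orders.

module _ (G : Graph n) where
  open Graph G renaming (sym to N-sym)

  induced : Subset n → Subgraph G
  induced S = record { V = S ; N = M ; N⊆V = M⊆S _ ; N⊆G = M⊆N _ ; sym = M-sym }
    where
    M : Fin n → Subset n
    -- Without the test, a vertex outside `S` would keep its neighbours in `S`, and symmetry would
    -- fail.
    M v = if lookupⱽ S v then N v ∩ S else ⊥
    M⁻ : ∀ v {u} → u ∈ M v → v ∈ S × u ∈ N v × u ∈ S
    M⁻ v u∈Mv with lookupⱽ S v in eq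
    ... | true  = lookup⇒[]= v S eq , x∈p∩q⁻ (N v) S u∈Mv
    ... | false = contradiction u∈Mv ∉⊥
    M⁺ : ∀ v {u} → v ∈ S → u ∈ N v → u ∈ S → u ∈ M v
    M⁺ v v∈S u∈Nv u∈S rewrite []=⇒lookup v∈S = x∈p∩q⁺ (u∈Nv , u∈S)
    M⊆S : ∀ v {u} → u ∈ M v → u ∈ S
    M⊆S v = proj₂ ∘ proj₂ ∘ M⁻ v
    M⊆N : ∀ v {u} → u ∈ M v → u ∈ N v
    M⊆N v = proj₁ ∘ proj₂ ∘ M⁻ v
    M-sym : ∀ {u v} → u ∈ M v → v ∈ M u
    M-sym {u} {v} u∈Mv with v∈S , u∈Nv , u∈S ← M⁻ v u∈Mv = M⁺ u u∈S (N-sym u∈Nv) v∈S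

  degree-induced : ∀ {S v} → v ∈ S → Subgraph.degree (induced S) v ≡ ∣ N v ∩ S ∣
  degree-induced v∈S rewrite []=⇒lookup v∈S = refl

  -- All conditions are relative to `S`, so `rank` may be arbitrary elsewhere. Duplicate-free lists
  -- stand for sets of earlier neighbours.
  record DegeneracyOrder (k : ℕ) (S : Subset n) (m : ℕ) : Set where
    field
      rank     : Fin n → ℕ
      rank<    : ∀ {v} → v ∈ S → rank v < m
      rank-inj : ∀ {u v} → u ∈ S → v ∈ S → rank u ≡ rank v → u ≡ v
      few-back : ∀ {v xs} → v ∈ S → Unique xs →
                 All (λ u → u ∈ S × u ∈ N v × rank u < rank v) xs → length xs ≤ k

  -- A vertex `x` of degree at most `k` in the subgraph induced on `S` gets the top rank, and
  -- `S - x` is ordered recursively. The earlier neighbours of `x` are then among its neighbours in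
  -- `S`, and `x` is earlier than no other vertex of `S`. The bound `m` on the size of `S` drives
  -- the recursion.
  degenerate⇒order : ∀ {k} → Degenerate k G → ∀ m S → ∣ S ∣ ≤ m → DegeneracyOrder k S m
  degenerate⇒order deg m S ∣S∣≤m with nonempty? S
  degenerate⇒order deg m S ∣S∣≤m | no S-empty = record
    { rank     = const 0
    ; rank<    = λ v∈S → ⊥-elim (S-empty (_ , v∈S))
    ; rank-inj = λ u∈S → ⊥-elim (S-empty (_ , u∈S))
    ; few-back = λ v∈S → ⊥-elim (S-empty (_ , v∈S))
    }
  degenerate⇒order deg zero S ∣S∣≤0 | yes (x , x∈S) =
    contradiction (≤-trans (x∈p⇒∣p-x∣<∣p∣ x∈S) ∣S∣≤0) λ ()
  degenerate⇒order {k} deg (suc m) S ∣S∣≤m | yes S≢∅ with deg (induced S) S≢∅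
  ... | x , x∈S , deg≤k = record
    { rank = rank ; rank< = rank< ; rank-inj = rank-inj ; few-back = few-back }
    where
    module R = DegeneracyOrder (degenerate⇒order deg m (S - x)
                 (s≤s⁻¹ (≤-trans (x∈p⇒∣p-x∣<∣p∣ x∈S) ∣S∣≤m)))
    rank = updateAt R.rank x (const m)
    rank-x : rank x ≡ m
    rank-x = updateAt-updates x R.rank
    rank-y : ∀ {y} → y ≢ x → rank y ≡ R.rank y
    rank-y {y} y≢x = updateAt-minimal y x R.rank y≢x
    rank-y<m : ∀ {y} → y ∈ S → y ≢ x → rank y < m
    rank-y<m y∈S y≢x = ≤-trans (≤-reflexive (cong suc (rank-y y≢x))) (R.rank< (x∈p∧x≢y⇒x∈p-y y∈S y≢x))
    rank< : ∀ {v} → v ∈ S → rank v < suc m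
    rank< {v} v∈S with v ≟ᶠ x
    ... | yes refl = s≤s (≤-reflexive rank-x)
    ... | no  v≢x  = m<n⇒m<1+n (rank-y<m v∈S v≢x)
    rank-inj : ∀ {u v} → u ∈ S → v ∈ S → rank u ≡ rank v → u ≡ v
    rank-inj {u} {v} u∈S v∈S eq with u ≟ᶠ x | v ≟ᶠ x
    ... | yes refl | yes refl = refl
    ... | yes refl | no  v≢x  = contradiction (trans (sym eq) rank-x) (<⇒≢ (rank-y<m v∈S v≢x))
    ... | no  u≢x  | yes refl = contradiction (trans eq rank-x) (<⇒≢ (rank-y<m u∈S u≢x))
    ... | no  u≢x  | no  v≢x  = R.rank-inj (x∈p∧x≢y⇒x∈p-y u∈S u≢x) (x∈p∧x≢y⇒x∈p-y v∈S v≢x)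
                                  (trans (sym (rank-y u≢x)) (trans eq (rank-y v≢x)))
    few-back : ∀ {v xs} → v ∈ S → Unique xs →
               All (λ u → u ∈ S × u ∈ N v × rank u < rank v) xs → length xs ≤ k
    few-back {v} v∈S xs! xs-back with v ≟ᶠ x
    ... | yes refl = ≤-trans
      (unique⇒length≤∣∣ xs! (All.map (λ (u∈S , u∈N , _) → x∈p∩q⁺ (u∈N , u∈S)) xs-back))
      (≤-trans (≤-reflexive (sym (degree-induced x∈S))) deg≤k)
    ... | no  v≢x = R.few-back (x∈p∧x≢y⇒x∈p-y v∈S v≢x) xs! (All.map restrict xs-back)
      where
      restrict : ∀ {u} → u ∈ S × u ∈ N v × rank u < rank v → u ∈ S - x × u ∈ N v × R.rank u < R.rank v
      restrict {u} (u∈S , u∈N , u<v) =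
        x∈p∧x≢y⇒x∈p-y u∈S u≢x , u∈N , subst₂ _<_ (rank-y u≢x) (rank-y v≢x) u<v
        where
        u≢x : u ≢ x
        u≢x refl = <-asym u<v (subst (rank v <_) (sym rank-x) (rank-y<m v∈S v≢x))

  -- Colourings as absence of conflicts.

  -- What two distinct vertices of the given colour must avoid; for a 2-independent part, a walk of
  -- length one or two between them.
  Conflict : ∀ {k b} → Fin k ⊎ Fin b → Fin n → Fin n → Set
  Conflict (inj₁ _) u v = u ∈ N v
  Conflict (inj₂ _) u v = u ∈ N v ⊎ ∃[ w ] (u ∈ N w × w ∈ N v)

  conflict-sym : ∀ {k b} (c : Fin k ⊎ Fin b) {u v} → Conflict c u v → Conflict c v u
  conflict-sym (inj₁ _) u∈Nv                     = N-sym u∈Nv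
  conflict-sym (inj₂ _) (inj₁ u∈Nv)              = inj₁ (N-sym u∈Nv)
  conflict-sym (inj₂ _) (inj₂ (w , u∈Nw , w∈Nv)) = inj₂ (w , N-sym w∈Nv , N-sym u∈Nw)

  conflict-free⇒colorable : ∀ {k b} (f : Fin n → Fin k ⊎ Fin b) →
    (∀ {u v} → u ≢ v → f u ≡ f v → ¬ Conflict (f v) u v) → Colorable G k b
  conflict-free⇒colorable {k} {b} f free = f , independent , 2-independent
    where
    independent : ∀ i → Independent G (λ v → f v ≡ inj₁ i)
    independent i fu≡i fv≡i u∈Nv = free (λ { refl → irrefl u∈Nv }) (trans fu≡i (sym fv≡i))
      (subst (λ c → Conflict c _ _) (sym fv≡i) u∈Nv)
    2-independent : ∀ j → 2-Independent G (λ v → f v ≡ inj₂ j)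
    2-independent j {u} {v} fu≡j fv≡j u≢v walk = go walk
      where
      free′ : ¬ Conflict {k} {b} (inj₂ j) u v
      free′ = free u≢v (trans fu≡j (sym fv≡j)) ∘ subst (λ c → Conflict c u v) (sym fv≡j)
      go : DistanceAtLeast G 3 u v
      go []                          = contradiction refl u≢v
      go (v∈Nu ∷ [])                 = contradiction (inj₁ (N-sym v∈Nu)) free′
      go (w∈Nu ∷ (v∈Nw ∷ []))        = contradiction (inj₂ (_ , N-sym w∈Nu , N-sym v∈Nw)) free′
      go (_ ∷ (_ ∷ (_ ∷ _)))         = s≤s (s≤s (s≤s z≤n))

  -- Colouring a graph along an order with few earlier neighbours.

  module Ordered {k : ℕ} (r : Fin n → ℕ) (r<n : ∀ v → r v < n) (r-inj : Injective _≡_ _≡_ r) where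

    Precedes : Fin n → Fin n → Set
    Precedes u v = u ∈ N v × r u < r v

    precedes? : B.Decidable Precedes
    precedes? u v = u ∈? N v ×-dec r u <? r v

    back forward : Fin n → List (Fin n)
    back v    = filter (λ u → precedes? u v) (allFin n)
    forward u = filter (precedes? u) (allFin n)

    ∈-back : ∀ {u v} → Precedes u v → u ∈ᴸ back v
    ∈-back {u} {v} = ∈-filter⁺ (λ u → precedes? u v) (∈-allFin u)

    ∈-back⁻ : ∀ {u v} → u ∈ᴸ back v → Precedes u v
    ∈-back⁻ {v = v} = proj₂ ∘ ∈-filter⁻ (λ u → precedes? u v) {xs = allFin n}

    ∈-forward : ∀ {u v} → Precedes u v → v ∈ᴸ forward u
    ∈-forward {u} {v} = ∈-filter⁺ (precedes? u) (∈-allFin v)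

    module _ (back≤k : ∀ v → length (back v) ≤ k) where

      -- Pairs in `Precedes` are counted twice: each later vertex lies in at most `k` of them, and
      -- each high vertex is the earlier one in at least `d`.
      high-count : ∀ {High : Fin n → Set} (High? : U.Decidable High) {d} →
        (∀ {v} → High v → d ≤ length (forward v)) → length (filter High? (allFin n)) * d ≤ n * k
      high-count High? {d} high⇒d≤ = begin
        length (filter High? (allFin n)) * d       ≤⟨ markov High? (length ∘ forward) high⇒d≤ (allFin n) ⟩
        sum (map (length ∘ forward) (allFin n))    ≡⟨ double-count precedes? (allFin n) (allFin n) ⟩
        sum (map (length ∘ back) (allFin n))       ≤⟨ sum-map-≤ (length ∘ back) (allFin n) back≤k ⟩
        length (allFin n) * k                      ≡⟨ cong (_* k) (length-tabulate {n = n} id) ⟩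
        n * k                                      ∎
        where open ≤-Reasoning

      module _ {High : Fin n → Set} (High? : U.Decidable High) {b d : ℕ}
        (low⇒≤d : ∀ {v} → ¬ High v → length (forward v) ≤ d)
        -- The left side bounds the length of `highs ++ second v`, the list whose colours a low
        -- vertex may have to avoid.
        (room : length (filter High? (allFin n)) + (k * (d + k) + d * k) < b) where

        open Prioritise High? r r<n r-inj

        highs : List (Fin n)
        highs = filter High? (allFin n)

        ∈-highs : ∀ {v} → High v → v ∈ᴸ highs
        ∈-highs {v} = ∈-filter⁺ High? (∈-allFin v)

        Color : Set
        Color = Fin k ⊎ Fin b

        _≟ᶜ_ : DecidableEquality Color
        _≟ᶜ_ = ≡-dec _≟ᶠ_ _≟ᶠ_

        IsInj₁ : Color → Set
        IsInj₁ c = ∃[ i ] c ≡ inj₁ i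

        isInj₁? : U.Decidable IsInj₁
        isInj₁? (inj₁ i) = yes (i , refl)
        isInj₁? (inj₂ j) = no λ ()

        -- The second condition keeps high vertices out of the independent parts. Hence they never
        -- block an independent colour, and a treated vertex with such a colour is known to be low.
        Admissible : Fin n → (Fin n → Color) → Color → Set
        Admissible v f c = (∀ u → prio u < prio v → f u ≡ c → ¬ Conflict c u v) × (IsInj₁ c → ¬ High v)

        admissible-local : ∀ {v f g c} → (∀ u → prio u < prio v → f u ≡ g u) →
          Admissible v f c → Admissible v g c
        admissible-local f≗g (free , low) = (λ u u<v gu≡c → free u u<v (trans (f≗g u u<v) gu≡c)) , low

        -- Meant to contain every `u` before `v` in `r` that shares a neighbour `w` with `v`. If `w`
        -- comes before `v`, then `u` may lie on either side of `w`. If `w` comes after `v`, it also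
        -- comes after `u`, so `back w` suffices and `w` may be high.
        second : Fin n → List (Fin n)
        second v = concatMap (λ w → forward w ++ back w) (back v) ++ concatMap back (forward v)

        ∈-second : ∀ {u v w} → r u < r v → u ∈ N w → w ∈ N v → u ∈ᴸ second v
        ∈-second {u} {v} {w} u<v u∈Nw w∈Nv with <-cmp (r w) (r v)
        ... | tri≈ _ rw≡rv _ = contradiction (subst (_∈ N v) (r-inj rw≡rv) w∈Nv) irrefl
        ... | tri> _ _ v<w   = ∈-++⁺ʳ _ (∈-concatMap⁺ back
                (lose (∈-forward (N-sym w∈Nv , v<w)) (∈-back (u∈Nw , <-trans u<v v<w))))
        ... | tri< w<v _ _   = ∈-++⁺ˡ (∈-concatMap⁺ (λ w → forward w ++ back w)
                (lose (∈-back (w∈Nv , w<v)) u∈around-w))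
          where
          u∈around-w : u ∈ᴸ forward w ++ back w
          u∈around-w with <-cmp (r u) (r w)
          ... | tri≈ _ ru≡rw _ = contradiction (subst (_∈ N w) (r-inj ru≡rw) u∈Nw) irrefl
          ... | tri< u<w _ _   = ∈-++⁺ʳ _ (∈-back (u∈Nw , u<w))
          ... | tri> _ _ w<u   = ∈-++⁺ˡ (∈-forward (N-sym u∈Nw , w<u))

        -- The first summand counts through earlier neighbours, whose lists `forward w` are short
        -- because they are low; the second counts through the later neighbours of `v`.
        length-second : ∀ {v} → ¬ High v → (∀ {w} → w ∈ᴸ back v → ¬ High w) →
          length (second v) ≤ k * (d + k) + d * k
        length-second {v} v-low back-low = begin
          length (second v)
            ≡⟨ length-++ (concatMap (λ w → forward w ++ back w) (back v)) ⟩
          length (concatMap (λ w → forward w ++ back w) (back v)) + length (concatMap back (forward v))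
            ≤⟨ +-mono-≤
                 (length-concatMap-≤ _ {xs = back v} (All.tabulate λ {w} w∈ → ≤-trans (≤-reflexive (length-++ (forward w)))
                   (+-mono-≤ (low⇒≤d (back-low w∈)) (back≤k w))))
                 (length-concatMap-≤ back {xs = forward v} (All.tabulate λ {w} _ → back≤k w)) ⟩
          length (back v) * (d + k) + length (forward v) * k
            ≤⟨ +-mono-≤ (*-monoˡ-≤ (d + k) (back≤k v)) (*-monoˡ-≤ k (low⇒≤d v-low)) ⟩
          k * (d + k) + d * k ∎
          where open ≤-Reasoning

        high-color : ∀ {v} → High v → ∀ f → ∃ (Admissible v f)
        high-color v-high f
          with j , free ← ∃-avoiding _≟ᶜ_ inj₂ inj₂-injective f highs (≤-<-trans (m≤m+n _ _) room)
          = inj₂ j , (λ u u<v fu≡j _ → free (∈-highs (before-P v-high u<v)) fu≡j) , λ ()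

        low-color : ∀ {v} → ¬ High v → ∀ f → (∀ u → prio u < prio v → Admissible u f (f u)) →
          ∃ (Admissible v f)
        low-color {v} v-low f ok with all? (isInj₁? ∘ f) (back v)
        ... | no ¬all
          -- Some entry of `back v` has no independent colour, so the filtered list has fewer than
          -- `k` entries.
          with i , free ← ∃-avoiding _≟ᶜ_ inj₁ inj₁-injective f (filter (isInj₁? ∘ f) (back v))
                 (<-≤-trans (filter-notAll (isInj₁? ∘ f) (back v) (¬All⇒Any¬ (isInj₁? ∘ f) (back v) ¬all))
                   (back≤k v))
          = inj₁ i , no-conflict , λ _ → v-low
          where
          no-conflict : ∀ u → prio u < prio v → f u ≡ inj₁ i → ¬ u ∈ N v
          no-conflict u u<v fu≡i u∈Nv with before-¬P⁻ v-low u<v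
          -- A high neighbour may follow `v` in `r` and be missing from `back v`, but it has no
          -- independent colour.
          ... | inj₁ u-high = proj₂ (ok u u<v) (i , fu≡i) u-high
          ... | inj₂ ru<rv  = free (∈-filter⁺ (isInj₁? ∘ f) (∈-back (u∈Nv , ru<rv)) (i , fu≡i)) fu≡i
        ... | yes all
          -- The earlier neighbours have independent colours, hence are low by `Admissible`, as
          -- `length-second` requires.
          with j , free ← ∃-avoiding _≟ᶜ_ inj₂ inj₂-injective f (highs ++ second v)
                 (≤-<-trans (≤-trans (≤-reflexive (length-++ highs))
                   (+-monoʳ-≤ (length highs) (length-second v-low λ {w} w∈ →
                     proj₂ (ok w (before-¬P⁺ v-low (inj₂ (proj₂ (∈-back⁻ w∈)))))
                       (All.lookup all w∈)))) room)
          = inj₂ j , no-conflict , λ ()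
          where
          no-conflict : ∀ u → prio u < prio v → f u ≡ inj₂ j →
            ¬ (u ∈ N v ⊎ ∃[ w ] (u ∈ N w × w ∈ N v))
          no-conflict u u<v fu≡j conflict with before-¬P⁻ v-low u<v | conflict
          ... | inj₁ u-high | _ = free (∈-++⁺ˡ (∈-highs u-high)) fu≡j
          ... | inj₂ ru<rv  | inj₁ u∈Nv
            with () ← trans (sym fu≡j) (proj₂ (All.lookup all (∈-back (u∈Nv , ru<rv))))
          ... | inj₂ ru<rv  | inj₂ (w , u∈Nw , w∈Nv) =
            free (∈-++⁺ʳ highs (∈-second ru<rv u∈Nw w∈Nv)) fu≡j

        admissible-color : ∀ v f → (∀ u → prio u < prio v → Admissible u f (f u)) → ∃ (Admissible v f)
        admissible-color v f ok = [ (λ v-high → high-color v-high f) , (λ v-low → low-color v-low f ok) ]′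
          (toSum (High? v))

        ordered⇒colorable : Colorable G k b
        ordered⇒colorable
          with f , ok ← Greedy.below prio prio-injective Admissible admissible-local admissible-color
                          -- The strict inequality `room` supplies some colour as placeholder. All
                          -- priorities are below `n + n`, so every vertex is treated.
                          (const (inj₂ (fromℕ< room))) (n + n)
          = conflict-free⇒colorable f free
          where
          free : ∀ {u v} → u ≢ v → f u ≡ f v → ¬ Conflict (f v) u v
          free {u} {v} u≢v fu≡fv conflict with <-cmp (prio u) (prio v)
          ... | tri< u<v _ _ = proj₁ (ok v (prio<n+n v)) u u<v fu≡fv conflict
          ... | tri≈ _ u≡v _ = u≢v (prio-injective u≡v)
          ... | tri> _ _ v<u = proj₁ (ok u (prio<n+n u)) v v<u (sym fu≡fv)
                  (conflict-sym (f u) (subst (λ c → Conflict c u v) (sym fu≡fv) conflict))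

-- Arithmetic of the bound.

-- A natural number b satisfies boundSq k n < (1 + b)² iff b is at least the
-- integer part of 4k√(k+1)√n; the bound on ex needs this sharp form.
module Threshold {k n b : ℕ} (k≥1 : k ≥ 1) (b<n : b < n) (bound : boundSq k n < suc b ^ 2) where

  private
    instance
      k≢0 : NonZero k
      k≢0 = >-nonZero k≥1
      4k≢0 : NonZero (4 * k)
      4k≢0 = m*n≢0 4 k

  open ≤-Reasoning

  c : ℕ
  c = suc b

  32k²n≤bound : 32 * (k * k) * n ≤ boundSq k n
  32k²n≤bound = *-monoˡ-≤ n (begin
    32 * (k * k)          ≡⟨ e k ⟩
    (4 * k) ^ 2 * 2       ≤⟨ *-monoʳ-≤ ((4 * k) ^ 2) (+-monoˡ-≤ 1 k≥1) ⟩
    (4 * k) ^ 2 * (k + 1) ∎)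
    where
    e : ∀ k → 32 * (k * k) ≡ (4 * k) * ((4 * k) * 1) * 2
    e = solve-∀

  32k²n<c² : 32 * (k * k) * n < c * c
  32k²n<c² = begin-strict
    32 * (k * k) * n ≤⟨ 32k²n≤bound ⟩
    boundSq k n      <⟨ bound ⟩
    c ^ 2            ≡⟨ cong (c *_) (*-identityʳ c) ⟩
    c * c            ∎

  -- From `b < n` follows `c ≤ n`, so a factor `c` cancels in `32k²n<c²`.
  32k²<c : 32 * (k * k) < c
  32k²<c = *-cancelʳ-< c _ _ (≤-<-trans (*-monoʳ-≤ (32 * (k * k)) b<n) 32k²n<c²)

  -- The threshold for high vertices. As `4 * k * d ≤ c`, the terms `2 * k * d` in `room` cost at
  -- most half of `c`, and the high vertices cost at most a quarter by `4h≤c`.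
  d : ℕ
  d = c / (4 * k)

  c<4k[1+d] : c < suc d * (4 * k)
  c<4k[1+d] = begin-strict
    c                            ≡⟨ m≡m%n+[m/n]*n c (4 * k) ⟩
    c % (4 * k) + d * (4 * k)    <⟨ +-monoˡ-< (d * (4 * k)) (m%n<n c (4 * k)) ⟩
    suc d * (4 * k)              ∎

  d≥1 : d ≥ 1
  d≥1 = n≢0⇒n>0 λ d≡0 → <-asym 32k²<c (begin-strict
    c               <⟨ c<4k[1+d] ⟩
    suc d * (4 * k) ≡⟨ cong (λ x → suc x * (4 * k)) d≡0 ⟩
    1 * (4 * k)     ≡⟨ *-identityˡ (4 * k) ⟩
    4 * k           ≤⟨ *-mono-≤ (m≤m+n 4 28) (m≤m*n k k) ⟩
    32 * (k * k)    ∎)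

  -- Multiplying `c < 4 * h` by the bound on `c` in terms of `d` would give
  -- `c * c ≤ 32 * k * (h * d)`, against `32k²n<c²`. The rounding in `d` is absorbed by
  -- `suc d ≤ d + d`.
  4h≤c : ∀ h → h * d ≤ n * k → 4 * h ≤ c
  4h≤c h hd≤nk = ≮⇒≥ λ c<4h → <-irrefl refl (begin-strict
    c * c                       ≤⟨ *-mono-≤ (<⇒≤ c<4k[1+d]) (<⇒≤ c<4h) ⟩
    suc d * (4 * k) * (4 * h)   ≤⟨ *-monoˡ-≤ (4 * h) (*-monoˡ-≤ (4 * k) (+-monoˡ-≤ d d≥1)) ⟩
    (d + d) * (4 * k) * (4 * h) ≡⟨ e₁ d k h ⟩
    32 * k * (h * d)            ≤⟨ *-monoʳ-≤ (32 * k) hd≤nk ⟩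
    32 * k * (n * k)            ≡⟨ e₂ k n ⟩
    32 * (k * k) * n            <⟨ 32k²n<c² ⟩
    c * c                       ∎)
    where
    e₁ : ∀ d k h → (d + d) * (4 * k) * (4 * h) ≡ 32 * k * (h * d)
    e₁ = solve-∀
    e₂ : ∀ k n → 32 * k * (n * k) ≡ 32 * (k * k) * n
    e₂ = solve-∀

  room : ∀ h → h * d ≤ n * k → h + (k * (d + k) + d * k) < b
  -- In units of `c`, after scaling by 8: two for `h`, four for the terms in `d`, one for `k * k`
  -- and the successor together, and one left for strictness.
  room h hd≤nk = s<s⁻¹ (*-cancelˡ-< 8 _ _ (begin-strict
    8 * suc (h + (k * (d + k) + d * k))                      ≡⟨ e₁ h k d ⟩
    2 * (4 * h) + 4 * (d * (4 * k)) + (8 * (k * k) + 8 * 1)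
      ≤⟨ +-mono-≤ (+-mono-≤ (*-monoʳ-≤ 2 (4h≤c h hd≤nk)) (*-monoʳ-≤ 4 (m/n*n≤m c (4 * k))))
           (+-monoʳ-≤ (8 * (k * k)) (*-monoʳ-≤ 8 (*-mono-≤ k≥1 k≥1))) ⟩
    2 * c + 4 * c + (8 * (k * k) + 8 * (k * k))              ≡⟨ e₂ c k ⟩
    6 * c + 16 * (k * k)
      ≤⟨ +-monoʳ-≤ (6 * c) (≤-trans (*-monoˡ-≤ (k * k) (m≤m+n 16 16)) (<⇒≤ 32k²<c)) ⟩
    6 * c + c                                                <⟨ m<m+n (6 * c + c) z<s ⟩
    6 * c + c + c                                            ≡⟨ e₃ c ⟩
    8 * c                                                    ∎))
    where
    e₁ : ∀ h k d → 8 * suc (h + (k * (d + k) + d * k))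
                     ≡ 2 * (4 * h) + 4 * (d * (4 * k)) + (8 * (k * k) + 8 * 1)
    e₁ = solve-∀
    e₂ : ∀ c k → 2 * c + 4 * c + (8 * (k * k) + 8 * (k * k)) ≡ 6 * c + 16 * (k * k)
    e₂ = solve-∀
    e₃ : ∀ c → 6 * c + c + c ≡ 8 * c
    e₃ = solve-∀

-- Colourability of degenerate graphs and the bound on ex.

n≤b⇒colorable : ∀ {k b} (G : Graph n) → n ≤ b → Colorable G k b
n≤b⇒colorable G n≤b = conflict-free⇒colorable G (λ v → inj₂ (inject≤ v n≤b))
  λ u≢v fu≡fv _ → u≢v (inject≤-injective n≤b n≤b _ _ (inj₂-injective fu≡fv))

degenerate⇒colorable : ∀ {k b} → k ≥ 1 → (G : Graph n) → Degenerate k G →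
  boundSq k n < suc b ^ 2 → Colorable G k b
degenerate⇒colorable {n} {k} {b} k≥1 G deg bound with n ≤? b
-- Here singletons suffice; the other case supplies the hypothesis `b < n` of `Threshold`.
... | yes n≤b = n≤b⇒colorable G n≤b
... | no  n≰b = ordered⇒colorable back≤k high? (<⇒≤ ∘ ≰⇒>)
                  (room (length (filter high? (allFin n))) (high-count back≤k high? id))
  where
  open Threshold k≥1 (≰⇒> n≰b) bound using (d; room)
  open DegeneracyOrder (degenerate⇒order G deg n ⊤ (≤-reflexive (∣⊤∣≡n n)))
  open Ordered G {k} rank (λ v → rank< ∈⊤) (rank-inj ∈⊤ ∈⊤)
  high? : U.Decidable (λ v → d ≤ length (forward v))
  high? v = d ≤? length (forward v)
  back≤k : ∀ v → length (back v) ≤ k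
  back≤k v = few-back ∈⊤ (Unique.filter⁺ (λ u → precedes? u v) (Unique.allFin⁺ n))
    (All.tabulate λ u∈back → ∈⊤ , ∈-back⁻ u∈back)

mainTheorem12 : (k : ℕ) → k ≥ 1 →
    ((n : ℕ) (G : Graph n) → Degenerate k G →
    (b : ℕ) → b ^ 2 ≥ boundSq k n → Colorable G k b)
    × ((n c : ℕ) → IsEx k (Degenerate k) n c → c ^ 2 ≤ boundSq k n)
mainTheorem12 k k≥1 = colorable , ex-bound
  where
  colorable : (n : ℕ) (G : Graph n) → Degenerate k G →
    (b : ℕ) → b ^ 2 ≥ boundSq k n → Colorable G k b
  colorable n G deg b b²≥ =
    degenerate⇒colorable k≥1 G deg (≤-<-trans b²≥ (^-monoˡ-< 2 (n<1+n b)))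
  ex-bound : (n c : ℕ) → IsEx k (Degenerate k) n c → c ^ 2 ≤ boundSq k n
  ex-bound n zero    _             = z≤n
  -- If the bound failed at `suc c`, the sharp form would show that `c` parts suffice, against
  -- minimality.
  ex-bound n (suc c) (_ , minimal) = ≮⇒≥ λ bound →
    1+n≰n (minimal c λ G deg → degenerate⇒colorable k≥1 G deg bound)
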